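{- There is an absolute constant $c>0$ such that the following holds. For any positive integers $n,d$ with $1\le d<n/8$, there exists a family of $d$-regular bipartite graphs with $n$ vertices on each side such that any deterministic algorithm for finding a perfect matching in the graphs of this family (given in adjacency array representation) requires at least $c\,nd$ time in the worst case over the graphs of the family and over the orderings of their adjacency arrays.
   Context: A bipartite graph $G=(P,Q,E)$ has vertex set $P\cup Q$ and edge set $E\subseteq P\times Q$; it is $d$-regular if every vertex has degree $d$, in which case $|P|=|Q|=n$ and $G$ has $nd$ edges. Adjacency array representation: for each vertex, its $d$ neighbors are stored in an array, and the algorithm accesses the graph by probing locations of these arrays, each probe revealing one neighbor of the chosen vertex. The ordering of neighbors within each array is arbitrary and may be chosen by an adversary. Each probe costs at least one unit of time. -}

module Defs where

open import Data.Bool.Base using (Bool; T)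
open import Data.Fin.Base using (Fin)
open import Data.Fin.Subset using (Subset; ∣_∣; _∈_)
open import Data.Integer.Base using (+_)
open import Data.Nat.Base using (ℕ; _+_; _≤_)
open import Data.Product.Base using (_×_; ∃-syntax)
open import Data.Product using (∃!)
open import Data.Rational.Base as ℚ using (ℚ; _/_)
open import Data.Sum.Base using (_⊎_; inj₁; inj₂)
open import Data.Vec.Base using (tabulate)
open import Function.Bundles using (_⇔_)
open import Function.Definitions using (Injective)
open import Level using (0ℓ)
open import Relation.Binary.PropositionalEquality using (_≡_)
open import Relation.Unary using (Pred)

-- P and Q are two disjoint copies of Fin n: inj₁ is P, inj₂ is Q.
Vertex : ℕ → Set
Vertex n = Fin n ⊎ Fin n

-- A subset of P × Q, the first argument being the endpoint in P.
EdgeSet : ℕ → Set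
EdgeSet n = Fin n → Fin n → Bool

BipartiteGraph : ℕ → Set
BipartiteGraph = EdgeSet

-- Neighbours are given by their index on the side opposite to the vertex.
neighbours : ∀ {n} → BipartiteGraph n → Vertex n → Subset n
neighbours E (inj₁ p) = tabulate λ q → E p q
neighbours E (inj₂ q) = tabulate λ p → E p q

degree : ∀ {n} → BipartiteGraph n → Vertex n → ℕ
degree G v = ∣ neighbours G v ∣

Regular : ∀ {n} → ℕ → BipartiteGraph n → Set
Regular d G = ∀ v → degree G v ≡ d

record PerfectMatching {n} (G : BipartiteGraph n) (M : EdgeSet n) : Set where
  field
    edges      : ∀ p q → T (M p q) → T (G p q)
    uniqueOn-P : ∀ p → ∃! _≡_ λ q → T (M p q)
    uniqueOn-Q : ∀ q → ∃! _≡_ λ p → T (M p q)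

-- One array of length d per vertex, on both sides of the graph.
Arrays : ℕ → ℕ → Set
Arrays n d = Vertex n → Fin d → Fin n

-- Each array lists the neighbours of its vertex exactly once, in any order;
-- orders at different vertices are unrelated.
record AdjacencyArrays {n d} (G : BipartiteGraph n) (a : Arrays n d) : Set where
  field
    injective : ∀ v → Injective _≡_ _≡_ (a v)
    lists     : ∀ v x → x ∈ neighbours G v ⇔ (∃[ i ] a v i ≡ x)

data Action (n d : ℕ) (State : Set) : Set where
  output  : EdgeSet n → Action n d State
  compute : State → Action n d State
  probe   : Vertex n → Fin d → (Fin n → State) → Action n d State

-- A deterministic algorithm, unrestricted apart from reading its input only
-- through probes. It need not halt on every input. Steps other than probes may
-- be free.
record Algorithm (n d : ℕ) : Set₁ where
  field
    State      : Set
    start      : State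
    action     : State → Action n d State
    cost       : State → ℕ
    probe-cost : ∀ {s v i next} → action s ≡ probe v i next → 1 ≤ cost s

module _ {n d} (A : Algorithm n d) (a : Arrays n d) where
  open Algorithm A

  -- From state s on arrays a, A halts with output M after total time t.
  data RunsFrom (s : State) (M : EdgeSet n) : ℕ → Set where
    halts    : action s ≡ output M → RunsFrom s M (cost s)
    computes : ∀ {s′ t} → action s ≡ compute s′ →
               RunsFrom s′ M t → RunsFrom s M (cost s + t)
    probes   : ∀ {v i next t} → action s ≡ probe v i next →
               RunsFrom (next (a v i)) M t → RunsFrom s M (cost s + t)

  Runs : EdgeSet n → ℕ → Set
  Runs = RunsFrom start

Family : ℕ → Set₁
Family n = Pred (BipartiteGraph n) 0ℓ

FindsPerfectMatching : ∀ {n d} → Algorithm n d → Family n → Set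
FindsPerfectMatching {n} {d} A F =
  ∀ G → F G → (a : Arrays n d) → AdjacencyArrays G a →
  ∃[ M ] ∃[ t ] Runs A a M t × PerfectMatching G M

fromℕ : ℕ → ℚ
fromℕ k = + k / 1

-- A is deterministic, so t below is the running time of A on a.
WorstCaseTimeAtLeast : ∀ {n d} → Algorithm n d → Family n → ℚ → Set
WorstCaseTimeAtLeast {n} {d} A F b =
  ∃[ G ] F G × (∃[ a ] AdjacencyArrays {n} {d} G a ×
  (∃[ M ] ∃[ t ] Runs A a M t × b ℚ.≤ fromℕ t))

{-# OPTIONS --safe #-}
module Submission where

-- The family consists of all graphs that have adjacency arrays of length d,
-- which are the d-regular ones, and c = 1/27.
--
-- The lower bound is an adversary argument. Call a vertex a decoy if its index
-- is divisible by 3. The adversary fixes one graph, `Base.graph`, in which every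
-- vertex has at least d / 3 decoy neighbours (rounded down), and only chooses
-- the order of the arrays: a new slot of a vertex reveals a decoy as long as that
-- vertex has a decoy neighbour not yet revealed at it. So a non-decoy is revealed at v
-- only after at least d / 3 other slots of v (`DecoysFirst`). The orders are
-- built along the run of the algorithm (`Adversary.force`); the construction is
-- cut short once nd different slots have been probed, since then the bound
-- already holds.
--
-- Let L be the list of the probed slots and M the output. Suppose that
-- 27 |L| < nd.
--
-- Every edge of M was revealed by some probe. Otherwise let (p , q) be an
-- unrevealed edge of M. At most 2d² edges (p′ , q′) have p′ adjacent to q or q′
-- adjacent to p, and at most |L| edges were revealed, so as n > 8d, one of the
-- nd edges avoids all of this (`SecondEdge.second-edge`). Replacing (p , q), (p′ , q′) by
-- (p , q′), (p′ , q) gives a d-regular graph, whose arrays agree with the old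
-- ones on all probed slots (`Switch`). The algorithm still outputs M, although
-- (p , q) is no longer an edge (`unseen⇒switch`).
--
-- At most 2 (n / 3 + 1) edges of M have a decoy as an endpoint. Each of the
-- others was revealed at one of its endpoints, where the revealed neighbour is
-- not a decoy, so at least d / 3 + 1 slots of that endpoint were probed. Edges
-- of M share no endpoint, so these slots are distinct
-- (`Charging.matching-cost`), and nd ≤ 27 |L| follows (`many-charges`).

open import Defs
open import Data.Bool.Base using (Bool; true; false; T)
open import Data.Bool.Properties using (T-≡; T?)
open import Data.Fin.Base using (Fin; zero; suc; toℕ; fromℕ<; inject≤; combine)
open import Data.Fin.Permutation.Components using (transpose)
import Data.Fin.Properties as Fin
open import Data.Fin.Subset using (Subset; inside; outside; ∣_∣) renaming (_∈_ to _∈ˢ_)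
import Data.Integer.Base as ℤ
open import Data.List.Base using (List; []; _∷_; length; lookup)
import Data.List.Membership.DecPropositional as DecMembership
open import Data.List.Membership.Propositional using (_∈_; _∉_; find)
open import Data.List.Relation.Binary.Subset.Propositional using (_⊆_)
open import Data.List.Relation.Unary.Any using (Any; here; there; index; any?)
open import Data.List.Relation.Unary.Any.Properties using (lookup-index)
open import Data.Nat.Base
  using (ℕ; zero; suc; NonZero; >-nonZero; _≤_; _<_; _*_; _+_; _∸_; _/_; _%_; _<ᵇ_; z≤n; s≤s)
open import Data.Nat.Divisibility using (_∣_; _∣?_; _∣0; ∣-refl; ∣m∣n⇒∣m+n)
open import Data.Nat.DivMod
open import Data.Nat.Properties hiding (_≟_)
open import Data.Nat.Tactic.RingSolver using (solve-∀)
open import Data.Product.Base using (Σ-syntax; ∃-syntax; _×_; _,_; proj₁; proj₂; map₂)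
import Data.Product.Properties as Product
open import Data.Rational.Base as ℚ using (ℚ; 0ℚ)
open import Data.Sum.Base using (_⊎_; inj₁; inj₂)
open import Data.Sum.Function.Propositional using (_⊎-cong_)
open import Data.Sum.Properties as Sum using (inj₁-injective; inj₂-injective)
open import Data.Vec.Base using (_∷_; here; there; tabulate)
open import Data.Vec.Properties using (lookup∘tabulate; lookup⇒[]=; []=⇒lookup)
open import Function.Base using (_∘_)
open import Function.Bundles using (_⇔_; mk⇔; _↔_; Equivalence; Injection; Inverse)
open import Function.Definitions using (Injective)
open import Function.Properties.Inverse using (↔-refl; ↔-sym; ↔-trans; ↔⇒↣)
open import Level using (0ℓ)
open import Relation.Binary.PropositionalEquality
open import Relation.Nullary using (¬_; Dec; yes; no; contradiction)
open import Relation.Nullary.Decidable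
  using (dec-true; dec-false; _⊎-dec_; _×-dec_; ¬?; decidable-stable)
open import Relation.Unary using (Pred; Decidable)

open Equivalence using (to; from)

private variable n d : ℕ

-- Injections and transpositions

injection⇒≤ : ∀ {A B : Set} {k l} → Fin k ↔ A → Fin l ↔ B →
              (f : A → B) → Injective _≡_ _≡_ f → k ≤ l
injection⇒≤ A↔ B↔ f f-inj = Fin.injective⇒≤ {f = Inverse.from B↔ ∘ f ∘ Inverse.to A↔} λ eq →
  Injection.injective (↔⇒↣ A↔) (f-inj (Injection.injective (↔⇒↣ (↔-sym B↔)) eq))

transpose-left : (i j : Fin n) → transpose i j i ≡ j
transpose-left i j rewrite dec-true (i Fin.≟ i) refl = refl

transpose-right : (i j : Fin n) → transpose i j j ≡ i
transpose-right i j with j Fin.≟ i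
... | yes j≡i = j≡i
... | no  _   rewrite dec-true (j Fin.≟ j) refl = refl

transpose-other : (i j : Fin n) {k : Fin n} → k ≢ i → k ≢ j → transpose i j k ≡ k
transpose-other i j {k} k≢i k≢j
  rewrite dec-false (k Fin.≟ i) k≢i | dec-false (k Fin.≟ j) k≢j = refl

transpose-involutive : (i j k : Fin n) → transpose i j (transpose i j k) ≡ k
transpose-involutive i j k = helper (k Fin.≟ i) (k Fin.≟ j)
  where
  helper : Dec (k ≡ i) → Dec (k ≡ j) → transpose i j (transpose i j k) ≡ k
  helper (yes refl) _          = trans (cong (transpose i j) (transpose-left i j)) (transpose-right i j)
  helper (no _)     (yes refl) = trans (cong (transpose i j) (transpose-right i j)) (transpose-left i j)
  helper (no k≢i)   (no k≢j)   =
    trans (cong (transpose i j) (transpose-other i j k≢i k≢j)) (transpose-other i j k≢i k≢j)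

involutive⇒injective : ∀ {A : Set} (f : A → A) → (∀ x → f (f x) ≡ x) → Injective _≡_ _≡_ f
involutive⇒injective f inv {x} {y} eq = trans (sym (inv x)) (trans (cong f eq) (inv y))

-- Cardinality of subsets, and regularity

-- The k-th smallest element of a subset; `rank` is its inverse.
member : (S : Subset n) → Fin ∣ S ∣ → Fin n
member (outside ∷ S) k       = suc (member S k)
member (inside  ∷ S) zero    = zero
member (inside  ∷ S) (suc k) = suc (member S k)

member-∈ : (S : Subset n) (k : Fin ∣ S ∣) → member S k ∈ˢ S
member-∈ (outside ∷ S) k       = there (member-∈ S k)
member-∈ (inside  ∷ S) zero    = here
member-∈ (inside  ∷ S) (suc k) = there (member-∈ S k)

member-injective : (S : Subset n) → Injective _≡_ _≡_ (member S)
member-injective (outside ∷ S) eq = member-injective S (Fin.suc-injective eq)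
member-injective (inside  ∷ S) {zero}  {zero}  eq = refl
member-injective (inside  ∷ S) {suc _} {suc _} eq =
  cong suc (member-injective S (Fin.suc-injective eq))

rank : (S : Subset n) {x : Fin n} → x ∈ˢ S → Fin ∣ S ∣
rank (outside ∷ S) (there x∈S) = rank S x∈S
rank (inside  ∷ S) here        = zero
rank (inside  ∷ S) (there x∈S) = suc (rank S x∈S)

member-rank : (S : Subset n) {x : Fin n} (x∈S : x ∈ˢ S) → member S (rank S x∈S) ≡ x
member-rank (outside ∷ S) (there x∈S) = cong suc (member-rank S x∈S)
member-rank (inside  ∷ S) here        = refl
member-rank (inside  ∷ S) (there x∈S) = cong suc (member-rank S x∈S)

arrays⇒regular : {G : BipartiteGraph n} {a : Arrays n d} → AdjacencyArrays G a → Regular d G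
arrays⇒regular {G = G} {a} valid v = ≤-antisym
    (Fin.injective⇒≤ {f = slotOf} slotOf-injective)
    (Fin.injective⇒≤ {f = λ i → rank S (listed i)} λ {i} {j} eq → injective v
      (trans (sym (member-rank S (listed i)))
        (trans (cong (member S) eq) (member-rank S (listed j)))))
  where
  open AdjacencyArrays valid
  S = neighbours G v
  slot : ∀ k → ∃[ i ] a v i ≡ member S k
  slot k = to (lists v (member S k)) (member-∈ S k)
  slotOf = proj₁ ∘ slot
  slotOf-injective : Injective _≡_ _≡_ slotOf
  slotOf-injective {k} {l} eq = member-injective S
    (trans (sym (proj₂ (slot k))) (trans (cong (a v) eq) (proj₂ (slot l))))
  listed : ∀ i → a v i ∈ˢ S
  listed i = from (lists v (a v i)) (i , refl)

-- Adjacency arrays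

-- Adjacency seen from either side: x is an index on the side opposite to v.
adjacent : BipartiteGraph n → Vertex n → Fin n → Bool
adjacent G (inj₁ p) x = G p x
adjacent G (inj₂ q) x = G x q

∈-tabulate : (f : Fin n → Bool) (x : Fin n) → x ∈ˢ tabulate f ⇔ T (f x)
∈-tabulate f x = mk⇔
  (λ x∈ → from T-≡ (trans (sym (lookup∘tabulate f x)) ([]=⇒lookup x∈)))
  (λ fx → lookup⇒[]= x _ (trans (lookup∘tabulate f x) (to T-≡ fx)))

∈-neighbours : (G : BipartiteGraph n) (v : Vertex n) (x : Fin n) →
               x ∈ˢ neighbours G v ⇔ T (adjacent G v x)
∈-neighbours G (inj₁ p) x = ∈-tabulate (G p) x
∈-neighbours G (inj₂ q) x = ∈-tabulate (λ p → G p q) x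

-- Adjacency arrays in terms of edges: each array has no repetition, contains
-- only neighbours, and contains all of them.
mkArrays : {G : BipartiteGraph n} {a : Arrays n d} →
           (∀ v → Injective _≡_ _≡_ (a v)) →
           (∀ v i → T (adjacent G v (a v i))) →
           (∀ v x → T (adjacent G v x) → ∃[ i ] a v i ≡ x) →
           AdjacencyArrays G a
mkArrays {G = G} inj sound complete = record
  { injective = inj
  ; lists     = λ v x → mk⇔
      (λ x∈ → complete v x (to (∈-neighbours G v x) x∈))
      (λ { (i , refl) → from (∈-neighbours G v x) (sound v i) })
  }

module Valid {G : BipartiteGraph n} {a : Arrays n d} (valid : AdjacencyArrays G a) where
  open AdjacencyArrays valid public using (injective)

  sound : ∀ v i → T (adjacent G v (a v i))
  sound v i = to (∈-neighbours G v _) (from (AdjacencyArrays.lists valid v _) (i , refl))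

  slot : ∀ v x → T (adjacent G v x) → ∃[ i ] a v i ≡ x
  slot v x t = to (AdjacencyArrays.lists valid v x) (from (∈-neighbours G v x) t)

-- A position in the arrays, which is what a probe reads.
Slot : ℕ → ℕ → Set
Slot n d = Vertex n × Fin d

_≟ᵛ_ : (v w : Vertex n) → Dec (v ≡ w)
_≟ᵛ_ = Sum.≡-dec Fin._≟_ Fin._≟_

_∈?_ : (s : Slot n d) (L : List (Slot n d)) → Dec (s ∈ L)
_∈?_ = DecMembership._∈?_ (Product.≡-dec _≟ᵛ_ Fin._≟_)

-- The two inputs cannot be told apart by probing slots in L.
Agree : List (Slot n d) → Arrays n d → Arrays n d → Set
Agree L a b = ∀ {v i} → (v , i) ∈ L → a v i ≡ b v i

-- X is the set of decoys (as indices, on both sides) and L the set of probed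
-- slots: once a non-decoy is revealed at v, all decoys in the array of v are.
DecoysFirst : Pred (Fin n) 0ℓ → Arrays n d → List (Slot n d) → Set
DecoysFirst X a L = ∀ {v i} j → (v , i) ∈ L → ¬ X (a v i) → X (a v j) → (v , j) ∈ L

-- Exchanging the entries of slots i and j in the array of v.
module _ (a : Arrays n d) (v : Vertex n) (i j : Fin d) where

  swapSlots : Arrays n d
  swapSlots w k with w ≟ᵛ v
  ... | yes _ = a w (transpose i j k)
  ... | no  _ = a w k

  swapSlots-at : ∀ k → swapSlots v k ≡ a v (transpose i j k)
  swapSlots-at k with v ≟ᵛ v
  ... | yes _   = refl
  ... | no  v≢v = contradiction refl v≢v

  swapSlots-valid : {G : BipartiteGraph n} → AdjacencyArrays G a → AdjacencyArrays G swapSlots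
  swapSlots-valid {G} valid = mkArrays inj snd cmp
    where
    open Valid valid
    inj : ∀ w → Injective _≡_ _≡_ (swapSlots w)
    inj w eq with w ≟ᵛ v
    ... | yes _ = involutive⇒injective _ (transpose-involutive i j) (injective w eq)
    ... | no  _ = injective w eq
    snd : ∀ w k → T (adjacent G w (swapSlots w k))
    snd w k with w ≟ᵛ v
    ... | yes _ = sound w _
    ... | no  _ = sound w _
    cmp : ∀ w x → T (adjacent G w x) → ∃[ k ] swapSlots w k ≡ x
    cmp w x t with w ≟ᵛ v | slot w x t
    ... | yes _ | k , eq = transpose i j k , trans (cong (a w) (transpose-involutive i j k)) eq
    ... | no  _ | k , eq = k , eq

  swapSlots-agree : ∀ {L} → (v , i) ∉ L → (v , j) ∉ L → Agree L a swapSlots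
  swapSlots-agree i∉ j∉ {w} {k} ∈L with w ≟ᵛ v
  ... | no  _    = refl
  ... | yes refl = cong (a w)
    (sym (transpose-other i j (λ { refl → i∉ ∈L }) (λ { refl → j∉ ∈L })))

-- Runs of a deterministic algorithm

module _ (A : Algorithm n d) where
  open Algorithm A

  Halts : Arrays n d → State → Set
  Halts a s = ∃[ M ] ∃[ t ] RunsFrom A a s M t

  after-compute : ∀ {a s s′ M t} → action s ≡ compute s′ → RunsFrom A a s M t →
                  ∃[ t′ ] RunsFrom A a s′ M t′
  after-compute eq (halts eq′) = contradiction (trans (sym eq) eq′) λ ()
  after-compute eq (computes eq′ r) with trans (sym eq) eq′
  ... | refl = _ , r
  after-compute eq (probes eq′ r) = contradiction (trans (sym eq) eq′) λ ()

  after-probe : ∀ {a s v i next M t} → action s ≡ probe v i next → RunsFrom A a s M t →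
                ∃[ t′ ] RunsFrom A a (next (a v i)) M t′
  after-probe eq (halts eq′) = contradiction (trans (sym eq) eq′) λ ()
  after-probe eq (computes eq′ r) = contradiction (trans (sym eq) eq′) λ ()
  after-probe eq (probes eq′ r) with trans (sym eq) eq′
  ... | refl = _ , r

  output-unique : ∀ {a s M M′ t t′} → RunsFrom A a s M t → RunsFrom A a s M′ t′ → M ≡ M′
  output-unique (halts eq) (halts eq′) with trans (sym eq) eq′
  ... | refl = refl
  output-unique (halts eq) (computes eq′ _) = contradiction (trans (sym eq) eq′) λ ()
  output-unique (halts eq) (probes eq′ _) = contradiction (trans (sym eq) eq′) λ ()
  output-unique (computes eq r) r′ = output-unique r (proj₂ (after-compute eq r′))
  output-unique (probes eq r) r′ = output-unique r (proj₂ (after-probe eq r′))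

-- The adversary

-- G is the graph that the adversary commits to, and N a number of probes after
-- which it may give up. Throughout, L lists the slots probed so far, each once,
-- and a is the current choice of arrays, of which only the slots in L are fixed.
module Adversary (A : Algorithm n d) (G : BipartiteGraph n)
                 {X : Pred (Fin n) 0ℓ} (X? : Decidable X) (N : ℕ) where
  open Algorithm A

  -- The adversary's move on a new slot (v , i): if some unprobed slot j of v holds
  -- a decoy, exchange slots i and j; otherwise all decoys of v are in L already.
  answer : ∀ {a L v i} → AdjacencyArrays G a → DecoysFirst X a L → (v , i) ∉ L →
           Σ[ b ∈ Arrays n d ]
             AdjacencyArrays G b × Agree L a b × DecoysFirst X b ((v , i) ∷ L)
  answer {a} {L} {v} {i} valid first i∉L
    with Fin.any? (λ j → X? (a v j) ×-dec ¬? ((v , j) ∈? L))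
  ... | yes (j , Xj , j∉L) =
    swapSlots a v i j , swapSlots-valid a v i j valid , agree , first′
    where
    agree : Agree L a (swapSlots a v i j)
    agree = swapSlots-agree a v i j i∉L j∉L
    first′ : DecoysFirst X (swapSlots a v i j) ((v , i) ∷ L)
    first′ k (here refl) ¬X Xk = contradiction
      (subst X (sym (trans (swapSlots-at a v i j i) (cong (a v) (transpose-left i j)))) Xj) ¬X
    first′ {w} k (there ∈L) ¬X Xk with w ≟ᵛ v | swapSlots-agree a v i j i∉L j∉L ∈L
    ... | no _     | eq = there (first k ∈L ¬X Xk)
    -- A non-decoy already revealed at v would have forced the decoy in slot j.
    ... | yes refl | eq = contradiction (first j ∈L (subst (¬_ ∘ X) (sym eq) ¬X) Xj) j∉L
  ... | no none = a , valid , (λ _ → refl) , first′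
    where
    first′ : DecoysFirst X a ((v , i) ∷ L)
    first′ k (here refl) ¬X Xk = there (decidable-stable (_ ∈? L) λ k∉L → none (k , Xk , k∉L))
    first′ k (there ∈L)  ¬X Xk = there (first k ∈L ¬X Xk)

  -- A list of at most t slots besides L whose contents determine the output M of
  -- the run from s, with the decoys revealed first.
  Certificate : State → Arrays n d → List (Slot n d) → EdgeSet n → ℕ → Set
  Certificate s b L M t = Σ[ L′ ∈ List (Slot n d) ] L ⊆ L′ × length L′ ≤ length L + t ×
    DecoysFirst X b L′ × (∀ c → Agree L′ b c → RunsFrom A c s M t)

  -- Arrays b refining the current choice, on which the run from s takes time t;
  -- either at least N probes or units of time are accounted for, or the slots
  -- probed form a certificate.
  record Forced (s : State) (a : Arrays n d) (L : List (Slot n d)) : Set where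
    field
      b       : Arrays n d
      valid   : AdjacencyArrays G b
      agree   : Agree L a b
      M       : EdgeSet n
      t       : ℕ
      run     : RunsFrom A b s M t
      outcome : N ≤ length L + t ⊎ Certificate s b L M t

  -- Prepending one transition from s to s′, after which L′ is known.
  step : ∀ {s s′ a a′ L L′} → Agree L a a′ → L ⊆ L′ → length L′ ≤ length L + cost s →
         (∀ {c M t} → Agree L′ a′ c → RunsFrom A c s′ M t → RunsFrom A c s M (cost s + t)) →
         Forced s′ a′ L′ → Forced s a L
  step {s} {L = L} {L′} ag L⊆L′ len lift f = record
    { b = b ; valid = valid ; agree = λ ∈L → trans (ag ∈L) (agree (L⊆L′ ∈L))
    ; M = M ; t = cost s + t ; run = lift agree run ; outcome = outcome′ outcome }
    where
    open Forced f
    longer : length L′ + t ≤ length L + (cost s + t)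
    longer = ≤-trans (+-monoˡ-≤ t len) (≤-reflexive (+-assoc (length L) (cost s) t))
    outcome′ : N ≤ length L′ + t ⊎ Certificate _ b L′ M t →
               N ≤ length L + (cost s + t) ⊎ Certificate s b L M (cost s + t)
    outcome′ (inj₁ N≤) = inj₁ (≤-trans N≤ longer)
    outcome′ (inj₂ (L″ , ⊆L″ , len″ , first , stable)) =
      inj₂ (L″ , (λ ∈L → ⊆L″ (L⊆L′ ∈L)) , ≤-trans len″ longer , first ,
            λ c (ag′ : Agree L″ b c) → lift (λ ∈L′ → trans (agree ∈L′) (ag′ (⊆L″ ∈L′))) (stable c ag′))

  -- Runs from s halt on every input compatible with what was revealed.
  Total : State → Arrays n d → List (Slot n d) → Set
  Total s a L = ∀ c → AdjacencyArrays G c → Agree L a c → Halts A c s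

  -- The adversary can play from any position at most k probes short of N.
  Forceable : ℕ → Set
  Forceable k = ∀ {s a L} → N ≤ length L + k → AdjacencyArrays G a → DecoysFirst X a L →
                Total s a L → Forced s a L

  -- Follows the run on the current arrays up to its first new slot. There the
  -- arrays may change, so the rest of the run is void, and the game restarts from
  -- the new arrays with one probe fewer to go.
  follow : ∀ {k s a L M t} → Forceable k → N ≤ length L + suc k → AdjacencyArrays G a →
           DecoysFirst X a L → Total s a L → RunsFrom A a s M t → Forced s a L
  follow _ _ valid first _ (halts eq) = record
    { valid = valid ; agree = λ _ → refl ; run = halts eq
    ; outcome = inj₂ (_ , (λ ∈L → ∈L) , m≤m+n _ _ , first , λ _ _ → halts eq) }
  follow rec N≤ valid first total (computes eq run) =
    step (λ _ → refl) (λ ∈L → ∈L) (m≤m+n _ _) (λ _ → computes eq)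
      (follow rec N≤ valid first
        (λ c vc ag → map₂ (λ (t , r) → after-compute A eq r) (total c vc ag)) run)
  follow {k} {a = a} {L} rec N≤ valid first total (probes {v} {i} {next} eq run) with (v , i) ∈? L
  ... | yes i∈L =
    step (λ _ → refl) (λ ∈L → ∈L) (m≤m+n _ _)
      (λ {c} {M} {t} ag r → probes eq (subst (λ x → RunsFrom A c (next x) M t) (ag i∈L) r))
      (follow rec N≤ valid first
        (λ c vc ag → subst (Halts A c ∘ next) (sym (ag i∈L))
          (map₂ (λ (t , r) → after-probe A eq r) (total c vc ag))) run)
  ... | no i∉L with answer valid first i∉L
  ...   | b , valid′ , ag , first′ =
    step ag there (≤-trans (≤-reflexive (+-comm 1 (length L))) (+-monoʳ-≤ (length L) (probe-cost eq)))
      (λ {c} {M} {t} ag′ r → probes eq (subst (λ x → RunsFrom A c (next x) M t) (ag′ (here refl)) r))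
      (rec (≤-trans N≤ (≤-reflexive (+-suc (length L) k))) valid′ first′ total′)
    where
    total′ : Total (next (b v i)) b ((v , i) ∷ L)
    total′ c vc ag′ = subst (Halts A c ∘ next) (sym (ag′ (here refl)))
      (map₂ (λ (t , r) → after-probe A eq r) (total c vc (λ ∈L → trans (ag ∈L) (ag′ (there ∈L)))))

  force : ∀ k → Forceable k
  force k N≤ valid first total with total _ valid (λ _ → refl)
  force zero    N≤ valid first total | _ , _ , run = record
    { valid = valid ; agree = λ _ → refl ; run = run
    ; outcome = inj₁ (≤-trans N≤ (+-monoʳ-≤ _ z≤n)) }
  force (suc k) N≤ valid first total | _ , _ , run = follow (force k) N≤ valid first total run

-- Switching two edges

-- Exchanges the values w and w′ in rows u and u′ only.
exchange : (u u′ w w′ : Fin n) → Fin n → Fin n → Fin n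
exchange u u′ w w′ x y with x Fin.≟ u | x Fin.≟ u′
... | no _ | no _ = y
... | _    | _    = transpose w w′ y

module _ (u u′ w w′ : Fin n) where

  exchange-involutive : ∀ x y → exchange u u′ w w′ x (exchange u u′ w w′ x y) ≡ y
  exchange-involutive x y with x Fin.≟ u | x Fin.≟ u′
  ... | yes _ | _     = transpose-involutive w w′ y
  ... | no _  | yes _ = transpose-involutive w w′ y
  ... | no _  | no _  = refl

  exchange-in : ∀ {x y} → x ≡ u ⊎ x ≡ u′ → exchange u u′ w w′ x y ≡ transpose w w′ y
  exchange-in {x} x∈ with x Fin.≟ u | x Fin.≟ u′ | x∈
  ... | yes _ | _     | _        = refl
  ... | no _  | yes _ | _        = refl
  ... | no x≢ | no _  | inj₁ x≡  = contradiction x≡ x≢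
  ... | no _  | no x≢ | inj₂ x≡  = contradiction x≡ x≢

  exchange-out : ∀ {x y} → x ≢ u → x ≢ u′ → exchange u u′ w w′ x y ≡ y
  exchange-out {x} x≢u x≢u′ with x Fin.≟ u | x Fin.≟ u′
  ... | yes x≡ | _      = contradiction x≡ x≢u
  ... | no _   | yes x≡ = contradiction x≡ x≢u′
  ... | no _   | no _   = refl

  exchange-fixes : ∀ x y → (x ≡ u ⊎ x ≡ u′ → y ≢ w × y ≢ w′) → exchange u u′ w w′ x y ≡ y
  exchange-fixes x y fix with x Fin.≟ u | x Fin.≟ u′
  ... | yes x≡ | _      = transpose-other w w′ (proj₁ (fix (inj₁ x≡))) (proj₂ (fix (inj₁ x≡)))
  ... | no _   | yes x≡ = transpose-other w w′ (proj₁ (fix (inj₂ x≡))) (proj₂ (fix (inj₂ x≡)))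
  ... | no _   | no _   = refl

  -- Where x lies with respect to the two rows.
  data Position (x : Fin n) : Set where
    firstOf  : x ≡ u  → Position x
    secondOf : x ≡ u′ → Position x
    neither  : x ≢ u → x ≢ u′ → Position x

  position : ∀ x → Position x
  position x with x Fin.≟ u | x Fin.≟ u′
  ... | yes x≡u | _        = firstOf x≡u
  ... | no _    | yes x≡u′ = secondOf x≡u′
  ... | no x≢u  | no x≢u′  = neither x≢u x≢u′

Edge : ℕ → Set
Edge n = Fin n × Fin n

-- The edge revealed by probing a slot.
edgeAt : Arrays n d → Slot n d → Edge n
edgeAt a (inj₁ p , i) = p , a (inj₁ p) i
edgeAt a (inj₂ q , i) = a (inj₂ q) i , q

Seen : Arrays n d → List (Slot n d) → Edge n → Set
Seen a L e = Any (λ s → edgeAt a s ≡ e) L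

seen? : (a : Arrays n d) (L : List (Slot n d)) → Decidable (Seen a L)
seen? a L e = any? (λ s → Product.≡-dec Fin._≟_ Fin._≟_ (edgeAt a s) e) L

∈⇒seen : ∀ {a : Arrays n d} {L e s} → s ∈ L → edgeAt a s ≡ e → Seen a L e
∈⇒seen (here refl) eq = here eq
∈⇒seen (there s∈L) eq = there (∈⇒seen s∈L eq)

-- Replacing the edges (p , q), (p′ , q′) by (p , q′), (p′ , q). In the rows of p
-- and p′ this exchanges the values q and q′, and in the columns of q and q′ the
-- values p and p′.
module Switch {G : BipartiteGraph n} {a : Arrays n d} (valid : AdjacencyArrays G a)
              {p p′ q q′ : Fin n}
              (pq : T (G p q)) (p′q′ : T (G p′ q′)) (¬pq′ : ¬ T (G p q′)) (¬p′q : ¬ T (G p′ q)) where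
  open Valid valid

  relabel : Vertex n → Fin n → Fin n
  relabel (inj₁ x) = exchange p p′ q q′ x
  relabel (inj₂ y) = exchange q q′ p p′ y

  relabel-involutive : ∀ v x → relabel v (relabel v x) ≡ x
  relabel-involutive (inj₁ x) = exchange-involutive p p′ q q′ x
  relabel-involutive (inj₂ y) = exchange-involutive q q′ p p′ y

  switched : BipartiteGraph n
  switched x y = G x (relabel (inj₁ x) y)

  switchedArrays : Arrays n d
  switchedArrays v i = relabel v (a v i)

  both-true : ∀ {b c} → T b → T c → b ≡ c
  both-true t u = trans (to T-≡ t) (sym (to T-≡ u))

  both-false : ∀ {b c} → ¬ T b → ¬ T c → b ≡ c
  both-false {true}          f g = contradiction _ f
  both-false {false} {true}  f g = contradiction _ g
  both-false {false} {false} f g = refl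

  -- The switch described by rows and the one described by columns coincide; at the
  -- four corners this uses which of them are edges.
  symmetric : ∀ x y → G x (relabel (inj₁ x) y) ≡ G (relabel (inj₂ y) x) y
  symmetric x y = helper (position p p′ q q′ x) (position q q′ p p′ y)
    where
    on-row : ∀ {x y} → x ≡ p ⊎ x ≡ p′ → relabel (inj₁ x) y ≡ transpose q q′ y
    on-row = exchange-in p p′ q q′
    on-col : ∀ {x y} → y ≡ q ⊎ y ≡ q′ → relabel (inj₂ y) x ≡ transpose p p′ x
    on-col = exchange-in q q′ p p′
    corner : ∀ {x y} → x ≡ p ⊎ x ≡ p′ → y ≡ q ⊎ y ≡ q′ →
             G x (transpose q q′ y) ≡ G (transpose p p′ x) y →
             G x (relabel (inj₁ x) y) ≡ G (relabel (inj₂ y) x) y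
    corner {x} {y} x∈ y∈ eq =
      trans (cong (G x) (on-row x∈)) (trans eq (sym (cong (λ z → G z y) (on-col y∈))))
    helper : ∀ {x y} → Position p p′ q q′ x → Position q q′ p p′ y →
             G x (relabel (inj₁ x) y) ≡ G (relabel (inj₂ y) x) y
    helper (firstOf refl) (firstOf refl) = corner (inj₁ refl) (inj₁ refl)
      (trans (cong (G p) (transpose-left q q′))
        (trans (both-false ¬pq′ ¬p′q) (sym (cong (λ z → G z q) (transpose-left p p′)))))
    helper (firstOf refl) (secondOf refl) = corner (inj₁ refl) (inj₂ refl)
      (trans (cong (G p) (transpose-right q q′))
        (trans (both-true pq p′q′) (sym (cong (λ z → G z q′) (transpose-left p p′)))))
    helper (secondOf refl) (firstOf refl) = corner (inj₂ refl) (inj₁ refl)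
      (trans (cong (G p′) (transpose-left q q′))
        (trans (both-true p′q′ pq) (sym (cong (λ z → G z q) (transpose-right p p′)))))
    helper (secondOf refl) (secondOf refl) = corner (inj₂ refl) (inj₂ refl)
      (trans (cong (G p′) (transpose-right q q′))
        (trans (both-false ¬p′q ¬pq′) (sym (cong (λ z → G z q′) (transpose-right p p′)))))
    helper {x} {y} (neither x≢p x≢p′) _ = trans
      (cong (G x) (exchange-out p p′ q q′ x≢p x≢p′))
      (sym (cong (λ z → G z y) (exchange-fixes q q′ p p′ y x λ _ → x≢p , x≢p′)))
    helper {x} {y} _ (neither y≢q y≢q′) = trans
      (cong (G x) (exchange-fixes p p′ q q′ x y λ _ → y≢q , y≢q′))
      (sym (cong (λ z → G z y) (exchange-out q q′ p p′ y≢q y≢q′)))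

  adjacent-switched : ∀ v x → adjacent switched v x ≡ adjacent G v (relabel v x)
  adjacent-switched (inj₁ x) y = refl
  adjacent-switched (inj₂ y) x = symmetric x y

  switched-valid : AdjacencyArrays switched switchedArrays
  switched-valid = mkArrays
    (λ v eq → injective v (involutive⇒injective (relabel v) (relabel-involutive v) eq))
    (λ v i → subst T (sym (trans (adjacent-switched v _)
                             (cong (adjacent G v) (relabel-involutive v (a v i))))) (sound v i))
    (λ v x t → map₂ (λ eq → trans (cong (relabel v) eq) (relabel-involutive v x))
                 (slot v _ (subst T (adjacent-switched v x) t)))

  ¬switched : ¬ T (switched p q)
  ¬switched t = ¬pq′ (subst (T ∘ G p) (trans (exchange-in p p′ q q′ (inj₁ refl)) (transpose-left q q′)) t)

  switched-agree : ∀ {L} → ¬ Seen a L (p , q) → ¬ Seen a L (p′ , q′) → Agree L a switchedArrays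
  switched-agree ¬seen ¬seen′ {inj₁ x} {i} ∈L = sym (exchange-fixes p p′ q q′ x (a (inj₁ x) i) λ where
    (inj₁ refl) → (λ eq → ¬seen (∈⇒seen ∈L (cong (p ,_) eq))) ,
                  (λ eq → ¬pq′ (subst (T ∘ G p) eq (sound (inj₁ p) i)))
    (inj₂ refl) → (λ eq → ¬p′q (subst (T ∘ G p′) eq (sound (inj₁ p′) i))) ,
                  (λ eq → ¬seen′ (∈⇒seen ∈L (cong (p′ ,_) eq))))
  switched-agree ¬seen ¬seen′ {inj₂ y} {i} ∈L = sym (exchange-fixes q q′ p p′ y (a (inj₂ y) i) λ where
    (inj₁ refl) → (λ eq → ¬seen (∈⇒seen ∈L (cong (_, q) eq))) ,
                  (λ eq → ¬p′q (subst (λ z → T (G z q)) eq (sound (inj₂ q) i)))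
    (inj₂ refl) → (λ eq → ¬pq′ (subst (λ z → T (G z q′)) eq (sound (inj₂ q′) i))) ,
                  (λ eq → ¬seen′ (∈⇒seen ∈L (cong (_, q′) eq))))

-- Finding the second edge of a switch

module SecondEdge {G : BipartiteGraph n} {a : Arrays n d} (valid : AdjacencyArrays G a)
                  (L : List (Slot n d)) (p q : Fin n) where
  open Valid valid

  -- (x , y) cannot serve as (p′ , q′) in an unnoticed switch with (p , q).
  Blocked : Fin n → Fin n → Set
  Blocked x y = T (G x q) ⊎ T (G p y) ⊎ Seen a L (x , y)

  blocked? : ∀ x y → Dec (Blocked x y)
  blocked? x y = T? (G x q) ⊎-dec T? (G p y) ⊎-dec seen? a L (x , y)

  -- A blocked edge (x , y) is determined by one of: the slot of x at q and that of
  -- y at x; the slot of y at p and that of x at y; the probe that revealed it.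
  Code : Set
  Code = (Fin d × Fin d) ⊎ (Fin d × Fin d) ⊎ Fin (length L)

  decode : Code → Edge n
  decode (inj₁ (j , i))        = let x = a (inj₂ q) j in x , a (inj₁ x) i
  decode (inj₂ (inj₁ (j , i))) = let y = a (inj₁ p) j in a (inj₂ y) i , y
  decode (inj₂ (inj₂ k))       = edgeAt a (lookup L k)

  encode : ∀ x i → Blocked x (a (inj₁ x) i) → ∃[ c ] decode c ≡ (x , a (inj₁ x) i)
  encode x i (inj₁ t) with slot (inj₂ q) x t
  ... | j , refl = inj₁ (j , i) , refl
  encode x i (inj₂ (inj₁ t)) with slot (inj₁ p) _ t | slot (inj₂ (a (inj₁ x) i)) x (sound (inj₁ x) i)
  ... | j , eq | k , eq′ = inj₂ (inj₁ (j , k)) ,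
    trans (cong (λ y → a (inj₂ y) k , y) eq) (cong (_, a (inj₁ x) i) eq′)
  encode x i (inj₂ (inj₂ seen)) = inj₂ (inj₂ (index seen)) , lookup-index seen

  all-blocked⇒≤ : (∀ x i → Blocked x (a (inj₁ x) i)) → n * d ≤ d * d + (d * d + length L)
  all-blocked⇒≤ blocked = injection⇒≤ Fin.*↔×
    (↔-trans Fin.+↔⊎ (Fin.*↔× ⊎-cong ↔-trans Fin.+↔⊎ (Fin.*↔× ⊎-cong ↔-refl)))
    (λ (x , i) → proj₁ (code x i)) λ {(x , i)} {(x′ , i′)} eq →
      same-slot (trans (sym (proj₂ (code x i))) (trans (cong decode eq) (proj₂ (code x′ i′))))
    where
    code : ∀ x i → ∃[ c ] decode c ≡ (x , a (inj₁ x) i)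
    code x i = encode x i (blocked x i)
    same-slot : ∀ {x i x′ i′} → (x , a (inj₁ x) i) ≡ (x′ , a (inj₁ x′) i′) → (x , i) ≡ (x′ , i′)
    same-slot {x} eq with cong proj₁ eq
    ... | refl = cong (x ,_) (injective (inj₁ x) (cong proj₂ eq))

  second-edge : d * d + (d * d + length L) < n * d →
                ∃[ x ] ∃[ i ] ¬ Blocked x (a (inj₁ x) i)
  second-edge few with Fin.any? (λ x → Fin.any? (λ i → ¬? (blocked? x (a (inj₁ x) i))))
  ... | yes found = found
  ... | no  none  = contradiction
    (all-blocked⇒≤ λ x i → decidable-stable (blocked? _ _) λ ¬b → none (x , i , ¬b))
    (<⇒≱ few)

-- The content of L does not imply that an unseen pair (p , q) is an edge.
unseen⇒switch : ∀ {G : BipartiteGraph n} {a : Arrays n d} {L p q} → AdjacencyArrays G a →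
                d * d + (d * d + length L) < n * d → T (G p q) → ¬ Seen a L (p , q) →
                ∃[ G′ ] ∃[ b ] AdjacencyArrays {n} {d} G′ b × Agree L a b × ¬ T (G′ p q)
unseen⇒switch {a = a} {L} {p} {q} valid few pq ¬seen
  with SecondEdge.second-edge valid L p q few
... | p′ , i , open? = switched , switchedArrays , switched-valid ,
                       switched-agree ¬seen (open? ∘ inj₂ ∘ inj₂) , ¬switched
  where open Switch valid pq (Valid.sound valid (inj₁ p′) i) (open? ∘ inj₂ ∘ inj₁) (open? ∘ inj₁)

-- Charging probes to matching edges

-- The map f is a perfect matching all of whose edges were revealed, every vertex
-- has m decoy neighbours, and there are at most r decoys on each side.
module Charging {G : BipartiteGraph n} {a : Arrays n d} (valid : AdjacencyArrays G a)
                {X : Pred (Fin n) 0ℓ} (X? : Decidable X) {L : List (Slot n d)}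
                (first : DecoysFirst X a L)
                {r m} (label : Fin n → Fin r)
                (label-injective : ∀ {x y} → X x → X y → label x ≡ label y → x ≡ y)
                (decoy : Vertex n → Fin m → Fin n)
                (decoy-injective : ∀ v → Injective _≡_ _≡_ (decoy v))
                (decoy-X : ∀ v k → X (decoy v k))
                (decoy-adjacent : ∀ v k → T (adjacent G v (decoy v k)))
                {f : Fin n → Fin n} (f-injective : Injective _≡_ _≡_ f)
                (seen : ∀ p → Seen a L (p , f p)) where
  open Valid valid

  -- An endpoint of the matching edge at p with at least m + 1 probed slots.
  record Charge (p : Fin n) : Set where
    field
      v       : Vertex n
      end     : v ≡ inj₁ p ⊎ v ≡ inj₂ (f p)
      slots   : Fin (suc m) → Fin d
      slots-injective : Injective _≡_ _≡_ slots
      probed  : ∀ k → (v , slots k) ∈ L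

  -- The slot of a revealed non-decoy, together with the slots of the m decoys.
  charge-at : ∀ {p v i} → v ≡ inj₁ p ⊎ v ≡ inj₂ (f p) → (v , i) ∈ L → ¬ X (a v i) → Charge p
  charge-at {v = v} {i} end i∈L ¬X = record
    { v = v ; end = end ; slots = slots ; slots-injective = inj ; probed = probed }
    where
    decoySlot : ∀ k → ∃[ j ] a v j ≡ decoy v k
    decoySlot k = slot v (decoy v k) (decoy-adjacent v k)
    X-decoySlot : ∀ k → X (a v (proj₁ (decoySlot k)))
    X-decoySlot k = subst X (sym (proj₂ (decoySlot k))) (decoy-X v k)
    slots : Fin (suc m) → Fin d
    slots zero    = i
    slots (suc k) = proj₁ (decoySlot k)
    inj : Injective _≡_ _≡_ slots
    inj {zero}  {zero}  eq = refl
    inj {zero}  {suc k} eq = contradiction (subst (X ∘ a v) (sym eq) (X-decoySlot k)) ¬X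
    inj {suc k} {zero}  eq = contradiction (subst (X ∘ a v) eq (X-decoySlot k)) ¬X
    inj {suc k} {suc l} eq = cong suc (decoy-injective v
      (trans (sym (proj₂ (decoySlot k))) (trans (cong (a v) eq) (proj₂ (decoySlot l)))))
    probed : ∀ k → (v , slots k) ∈ L
    probed zero    = i∈L
    probed (suc k) = first _ i∈L ¬X (X-decoySlot k)

  seen⇒charge : ∀ {p} → ¬ X p → ¬ X (f p) → Seen a L (p , f p) → Charge p
  seen⇒charge {p} ¬Xp ¬Xfp s with find s
  ... | (inj₁ x , i) , ∈L , eq = charge-at (inj₁ (cong (inj₁ ∘ proj₁) eq)) ∈L
          (subst (¬_ ∘ X) (sym (cong proj₂ eq)) ¬Xfp)
  ... | (inj₂ y , i) , ∈L , eq = charge-at (inj₂ (cong (inj₂ ∘ proj₂) eq)) ∈L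
          (subst (¬_ ∘ X) (sym (cong proj₁ eq)) ¬Xp)

  classify : ∀ p → X p ⊎ X (f p) ⊎ Charge p
  classify p with X? p | X? (f p)
  ... | yes Xp | _       = inj₁ Xp
  ... | no _   | yes Xfp = inj₂ (inj₁ Xfp)
  ... | no ¬Xp | no ¬Xfp = inj₂ (inj₂ (seen⇒charge ¬Xp ¬Xfp (seen p)))

  -- Pairs (p , k) with k ≤ m are injected into m + 1 copies of the decoys on either
  -- side, when the edge at p meets a decoy, and into the probed slots otherwise.
  Code : Set
  Code = (Fin r × Fin (suc m)) ⊎ (Fin r × Fin (suc m)) ⊎ Fin (length L)

  encode : ∀ {p} → X p ⊎ X (f p) ⊎ Charge p → Fin (suc m) → Code
  encode {p} (inj₁ _)        k = inj₁ (label p , k)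
  encode {p} (inj₂ (inj₁ _)) k = inj₂ (inj₁ (label (f p) , k))
  encode     (inj₂ (inj₂ c)) k = inj₂ (inj₂ (index (Charge.probed c k)))

  index-slot : ∀ {s s′ : Slot n d} (∈L : s ∈ L) (∈L′ : s′ ∈ L) → index ∈L ≡ index ∈L′ → s ≡ s′
  index-slot ∈L ∈L′ eq = trans (lookup-index ∈L) (trans (cong (lookup L) eq) (sym (lookup-index ∈L′)))

  same-end : ∀ {v p p′} → v ≡ inj₁ p ⊎ v ≡ inj₂ (f p) → v ≡ inj₁ p′ ⊎ v ≡ inj₂ (f p′) → p ≡ p′
  same-end (inj₁ refl) (inj₁ refl) = refl
  same-end (inj₁ refl) (inj₂ ())
  same-end (inj₂ refl) (inj₁ ())
  same-end (inj₂ refl) (inj₂ eq)   = f-injective (inj₂-injective eq)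

  encode-vertex : ∀ {p p′} (c : X p ⊎ X (f p) ⊎ Charge p) (c′ : X p′ ⊎ X (f p′) ⊎ Charge p′) {k k′} →
                  encode c k ≡ encode c′ k′ → p ≡ p′
  encode-vertex (inj₁ _) (inj₂ (inj₁ _)) ()
  encode-vertex (inj₁ _) (inj₂ (inj₂ _)) ()
  encode-vertex (inj₁ x) (inj₁ x′) eq =
    label-injective x x′ (cong proj₁ (inj₁-injective eq))
  encode-vertex (inj₂ (inj₁ x)) (inj₂ (inj₁ x′)) eq =
    f-injective (label-injective x x′ (cong proj₁ (inj₁-injective (inj₂-injective eq))))
  encode-vertex (inj₂ (inj₂ c)) (inj₂ (inj₂ c′)) {k} {k′} eq = same-end (C.end)
      (subst (λ v → v ≡ _ ⊎ v ≡ _) (sym (cong proj₁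
        (index-slot (C.probed k) (C′.probed k′) (inj₂-injective (inj₂-injective eq))))) C′.end)
    where
    module C = Charge c
    module C′ = Charge c′

  encode-index : ∀ {p} (c : X p ⊎ X (f p) ⊎ Charge p) → Injective _≡_ _≡_ (encode c)
  encode-index (inj₁ _)        refl = refl
  encode-index (inj₂ (inj₁ _)) refl = refl
  encode-index (inj₂ (inj₂ c)) {k} {k′} eq = C.slots-injective (cong proj₂
      (index-slot (C.probed k) (C.probed k′) (inj₂-injective (inj₂-injective eq))))
    where
    module C = Charge c

  matching-cost : n * suc m ≤ r * suc m + (r * suc m + length L)
  matching-cost = injection⇒≤ Fin.*↔×
    (↔-trans Fin.+↔⊎ (Fin.*↔× ⊎-cong ↔-trans Fin.+↔⊎ (Fin.*↔× ⊎-cong ↔-refl)))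
    (λ (p , k) → encode (classify p) k) same
    where
    same : Injective _≡_ _≡_ (λ ((p , k) : Fin n × Fin (suc m)) → encode (classify p) k)
    same {p , k} {p′ , k′} eq with encode-vertex (classify p) (classify p′) eq
    ... | refl = cong (p ,_) (encode-index (classify p) eq)

-- The graph of the adversary

module _ (n : ℕ) .{{_ : NonZero n}} where

  %-absorb : ∀ u w → (u + w % n) % n ≡ (u + w) % n
  %-absorb u w = trans (%-distribˡ-+ u (w % n) n)
    (trans (cong (λ z → (u % n + z) % n) (m%n%n≡m%n w n)) (sym (%-distribˡ-+ u w n)))

  n-complement : ∀ {u} w → u ≤ n → u + (w + (n ∸ u)) ≡ w + n
  n-complement {u} w u≤n = trans (swap u w (n ∸ u)) (cong (w +_) (m+[n∸m]≡n u≤n))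
    where
    swap : ∀ a b c → a + (b + c) ≡ b + (a + c)
    swap = solve-∀

  subtract-add : ∀ {u j} → u ≤ n → j < n → (u + (j + (n ∸ u)) % n) % n ≡ j
  subtract-add {u} {j} u≤n j<n = begin
    (u + (j + (n ∸ u)) % n) % n ≡⟨ %-absorb u (j + (n ∸ u)) ⟩
    (u + (j + (n ∸ u))) % n     ≡⟨ cong (_% n) (n-complement j u≤n) ⟩
    (j + n) % n                 ≡⟨ [m+n]%n≡m%n j n ⟩
    j % n                       ≡⟨ m<n⇒m%n≡m j<n ⟩
    j                           ∎
    where open ≡-Reasoning

  add-subtract : ∀ {u x} → u ≤ n → x < n → ((u + x) % n + (n ∸ u)) % n ≡ x
  add-subtract {u} {x} u≤n x<n = begin
    ((u + x) % n + (n ∸ u)) % n ≡⟨ cong (_% n) (+-comm ((u + x) % n) (n ∸ u)) ⟩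
    ((n ∸ u) + (u + x) % n) % n ≡⟨ %-absorb (n ∸ u) (u + x) ⟩
    ((n ∸ u) + (u + x)) % n     ≡⟨ cong (_% n) (swap (n ∸ u) u x) ⟩
    (u + (x + (n ∸ u))) % n     ≡⟨ cong (_% n) (n-complement x u≤n) ⟩
    (x + n) % n                 ≡⟨ [m+n]%n≡m%n x n ⟩
    x % n                       ≡⟨ m<n⇒m%n≡m x<n ⟩
    x                           ∎
    where
    open ≡-Reasoning
    swap : ∀ a b c → a + (b + c) ≡ b + (c + a)
    swap = solve-∀

index-of : Vertex n → Fin n
index-of (inj₁ p) = p
index-of (inj₂ q) = q

-- Vertices p and q are adjacent when (p + q) % n < d. This relation is symmetric
-- in p and q, so both sides have the same arrays: those of v list (j - v) % n for
-- j < d. Neighbours are thus cyclic intervals of length d.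
module Base (n d : ℕ) .{{_ : NonZero n}} (d≤n : d ≤ n) where

  graph : BipartiteGraph n
  graph p q = (toℕ p + toℕ q) % n <ᵇ d

  offset : Vertex n → ℕ
  offset v = toℕ (index-of v)

  offset≤n : ∀ v → offset v ≤ n
  offset≤n v = <⇒≤ (Fin.toℕ<n (index-of v))

  adjacent-graph : ∀ v x → adjacent graph v x ≡ ((offset v + toℕ x) % n <ᵇ d)
  adjacent-graph (inj₁ p) x = refl
  adjacent-graph (inj₂ q) x = cong (λ s → s % n <ᵇ d) (+-comm (toℕ x) (toℕ q))

  arrays : Arrays n d
  arrays v j = fromℕ< (m%n<n (toℕ j + (n ∸ offset v)) n)

  toℕ-arrays : ∀ v j → toℕ (arrays v j) ≡ (toℕ j + (n ∸ offset v)) % n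
  toℕ-arrays v j = Fin.toℕ-fromℕ< _

  arrays-sum : ∀ v j → (offset v + toℕ (arrays v j)) % n ≡ toℕ j
  arrays-sum v j = trans (cong (λ z → (offset v + z) % n) (toℕ-arrays v j))
    (subtract-add n (offset≤n v) (<-≤-trans (Fin.toℕ<n j) d≤n))

  arrays-injective : ∀ v → Injective _≡_ _≡_ (arrays v)
  arrays-injective v {i} {j} eq = Fin.toℕ-injective
    (trans (sym (arrays-sum v i))
      (trans (cong (λ x → (offset v + toℕ x) % n) eq) (arrays-sum v j)))

  arrays-adjacent : ∀ v j → T (adjacent graph v (arrays v j))
  arrays-adjacent v j = subst T (sym (adjacent-graph v _))
    (<⇒<ᵇ (subst (_< d) (sym (arrays-sum v j)) (Fin.toℕ<n j)))

  valid : AdjacencyArrays graph arrays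
  valid = mkArrays arrays-injective arrays-adjacent λ v x t →
    let sum<d = <ᵇ⇒< _ _ (subst T (adjacent-graph v x) t) in
    fromℕ< sum<d , Fin.toℕ-injective (trans (toℕ-arrays v _)
      (trans (cong (λ z → (z + (n ∸ offset v)) % n) (Fin.toℕ-fromℕ< sum<d))
        (add-subtract n (offset≤n v) (Fin.toℕ<n x))))

  complement₃ : ∀ y → ∃[ e ] 3 ∣ y + toℕ {3} e
  complement₃ zero = zero , 3 ∣0
  complement₃ (suc zero) = suc (suc zero) , ∣-refl
  complement₃ (suc (suc zero)) = suc zero , ∣-refl
  complement₃ (suc (suc (suc y))) = map₂ (∣m∣n⇒∣m+n ∣-refl) (complement₃ y)

  -- Among three cyclically consecutive residues mod n, one is divisible by 3.
  near-multiple : ∀ y → ∃[ e ] 3 ∣ (y + toℕ {3} e) % n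
  near-multiple y with complement₃ (y % n)
  ... | e , 3∣ with y % n + toℕ e <? n
  ...   | yes <n = e , subst (3 ∣_) (trans (sym (m<n⇒m%n≡m <n)) (reduce (toℕ e))) 3∣
    where
    reduce : ∀ e → (y % n + e) % n ≡ (y + e) % n
    reduce e = trans (cong (_% n) (+-comm (y % n) e))
      (trans (%-absorb n e y) (cong (_% n) (+-comm e y)))
  -- The three residues wrap around, so 0 is among them.
  ...   | no ≮n = fromℕ< gap<3 , subst (3 ∣_) (sym wraps) (3 ∣0)
    where
    gap = n ∸ y % n
    gap<3 : gap < 3
    gap<3 = ≤-<-trans (≤-trans (∸-monoˡ-≤ (y % n) (≮⇒≥ ≮n)) (≤-reflexive (m+n∸m≡n (y % n) (toℕ e))))
              (Fin.toℕ<n e)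
    wraps : (y + toℕ (fromℕ< gap<3)) % n ≡ 0
    wraps = begin
      (y + toℕ (fromℕ< gap<3)) % n ≡⟨ cong (λ z → (y + z) % n) (Fin.toℕ-fromℕ< gap<3) ⟩
      (y + gap) % n                ≡⟨ cong (_% n) (+-comm y gap) ⟩
      (gap + y) % n                ≡⟨ sym (%-absorb n gap y) ⟩
      (gap + y % n) % n            ≡⟨ cong (_% n) (m∸n+n≡m (m%n≤n y n)) ⟩
      n % n                        ≡⟨ n%n≡0 n ⟩
      0                            ∎
      where open ≡-Reasoning

  -- One decoy in each block of slots 3k, 3k + 1, 3k + 2 of v.
  decoyShift : ∀ v (k : Fin (d / 3)) → ∃[ e ] 3 ∣ (3 * toℕ k + (n ∸ offset v) + toℕ {3} e) % n
  decoyShift v k = near-multiple _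

  decoySlot : Vertex n → Fin (d / 3) → Fin d
  decoySlot v k = inject≤ (combine k (proj₁ (decoyShift v k))) (m/n*n≤m d 3)

  decoy : Vertex n → Fin (d / 3) → Fin n
  decoy v k = arrays v (decoySlot v k)

  decoy-injective : ∀ v → Injective _≡_ _≡_ (decoy v)
  decoy-injective v {k} {l} eq = Fin.combine-injectiveˡ k _ l _
    (Fin.inject≤-injective _ _ _ _ (arrays-injective v eq))

  decoy-multiple : ∀ v k → 3 ∣ toℕ (decoy v k)
  decoy-multiple v k = subst (3 ∣_) (sym eq) (proj₂ (decoyShift v k))
    where
    e = proj₁ (decoyShift v k)
    c = n ∸ offset v
    eq : toℕ (decoy v k) ≡ (3 * toℕ k + c + toℕ e) % n
    eq = begin
      toℕ (decoy v k)                     ≡⟨ toℕ-arrays v (decoySlot v k) ⟩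
      (toℕ (decoySlot v k) + c) % n       ≡⟨ cong (λ z → (z + c) % n) (Fin.toℕ-inject≤ _ _) ⟩
      (toℕ (combine k e) + c) % n         ≡⟨ cong (λ z → (z + c) % n) (Fin.toℕ-combine k e) ⟩
      (3 * toℕ k + toℕ e + c) % n         ≡⟨ cong (_% n) (swap (3 * toℕ k) (toℕ e) c) ⟩
      (3 * toℕ k + c + toℕ e) % n         ∎
      where
      open ≡-Reasoning
      swap : ∀ x y z → x + y + z ≡ x + z + y
      swap = solve-∀

  -- There are at most n / 3 + 1 multiples of 3 below n.
  third : Fin n → Fin (suc (n / 3))
  third x = fromℕ< (s≤s (/-monoˡ-≤ 3 (<⇒≤ (Fin.toℕ<n x))))

  third-injective : ∀ {x y} → 3 ∣ toℕ x → 3 ∣ toℕ y → third x ≡ third y → x ≡ y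
  third-injective {x} {y} 3∣x 3∣y eq = Fin.toℕ-injective
    (trans (sym (m/n*n≡m 3∣x)) (trans (cong (_* 3) quotients) (m/n*n≡m 3∣y)))
    where
    quotients : toℕ x / 3 ≡ toℕ y / 3
    quotients = trans (sym (Fin.toℕ-fromℕ< _)) (trans (cong toℕ eq) (Fin.toℕ-fromℕ< _))

-- Arithmetic of the two counts, where ℓ is the number of probed slots

module _ where
  open ≤-Reasoning

  few-blocked : ∀ n d ℓ → 8 * d < n → 27 * ℓ < n * d → d * d + (d * d + ℓ) < n * d
  few-blocked n d ℓ 8d<n 27ℓ<nd = *-cancelˡ-< 27 _ _ (begin-strict
    27 * (d * d + (d * d + ℓ))  ≡⟨ expand 27 (d * d) ℓ ⟩
    54 * (d * d) + 27 * ℓ       <⟨ +-monoʳ-< (54 * (d * d)) 27ℓ<nd ⟩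
    54 * (d * d) + n * d        ≤⟨ +-monoˡ-≤ (n * d) (*-monoˡ-≤ (d * d) (m≤m+n 54 154)) ⟩
    -- 208 = 26 · 8, which makes room for the hypothesis 8d < n.
    208 * (d * d) + n * d       ≡⟨ cong (_+ n * d) (trans (*-assoc 26 8 (d * d))
                                     (cong (26 *_) (sym (*-assoc 8 d d)))) ⟩
    26 * (8 * d * d) + n * d    ≤⟨ +-monoˡ-≤ (n * d) (*-monoʳ-≤ 26 (*-monoˡ-≤ d (<⇒≤ 8d<n))) ⟩
    26 * (n * d) + n * d        ≡⟨ +-comm (26 * (n * d)) (n * d) ⟩
    27 * (n * d)                ∎)
    where
    expand : ∀ k x ℓ → k * (x + (x + ℓ)) ≡ (k + k) * x + k * ℓ
    expand = solve-∀

  many-charges : ∀ n d ℓ → 9 ≤ n →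
    n * suc (d / 3) ≤ suc (n / 3) * suc (d / 3) + (suc (n / 3) * suc (d / 3) + ℓ) → n * d ≤ 27 * ℓ
  many-charges n d ℓ 9≤n charges = begin
    n * d         ≤⟨ *-monoʳ-≤ n d≤3μ ⟩
    n * (3 * μ)   ≡⟨ regroup₁ n μ ⟩
    3 * (n * μ)   ≤⟨ *-monoʳ-≤ 3 (+-cancelˡ-≤ (8 * (n * μ)) _ _ bound) ⟩
    3 * (9 * ℓ)   ≡⟨ sym (*-assoc 3 9 ℓ) ⟩
    27 * ℓ        ∎
    where
    μ = suc (d / 3)
    r = suc (n / 3)
    regroup₁ : ∀ n μ → n * (3 * μ) ≡ 3 * (n * μ)
    regroup₁ = solve-∀
    regroup₂ : ∀ ℓ r μ → 9 * (r * μ + (r * μ + ℓ)) ≡ 6 * (r * 3 * μ) + 9 * ℓ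
    regroup₂ = solve-∀
    regroup₃ : ∀ n ℓ μ → 6 * ((3 + n) * μ) + 9 * ℓ ≡ 6 * (n * μ) + 2 * (9 * μ) + 9 * ℓ
    regroup₃ = solve-∀
    d≤3μ : d ≤ 3 * μ
    d≤3μ = begin
      d                     ≡⟨ m≡m%n+[m/n]*n d 3 ⟩
      d % 3 + d / 3 * 3     ≤⟨ +-monoˡ-≤ (d / 3 * 3) (m%n≤n d 3) ⟩
      μ * 3                 ≡⟨ *-comm μ 3 ⟩
      3 * μ                 ∎
    bound : 8 * (n * μ) + n * μ ≤ 8 * (n * μ) + 9 * ℓ
    bound = begin
      8 * (n * μ) + n * μ                       ≡⟨ +-comm (8 * (n * μ)) (n * μ) ⟩
      9 * (n * μ)                               ≤⟨ *-monoʳ-≤ 9 charges ⟩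
      9 * (r * μ + (r * μ + ℓ))                 ≡⟨ regroup₂ ℓ r μ ⟩
      6 * (r * 3 * μ) + 9 * ℓ                   ≤⟨ +-monoˡ-≤ (9 * ℓ) (*-monoʳ-≤ 6
                                                     (*-monoˡ-≤ μ (+-monoʳ-≤ 3 (m/n*n≤m n 3)))) ⟩
      6 * ((3 + n) * μ) + 9 * ℓ                 ≡⟨ regroup₃ n ℓ μ ⟩
      6 * (n * μ) + 2 * (9 * μ) + 9 * ℓ         ≤⟨ +-monoˡ-≤ (9 * ℓ) (+-monoʳ-≤ (6 * (n * μ))
                                                     (*-monoʳ-≤ 2 (*-monoˡ-≤ μ 9≤n))) ⟩
      6 * (n * μ) + 2 * (n * μ) + 9 * ℓ         ≡⟨ cong (_+ 9 * ℓ) (sym (*-distribʳ-+ (n * μ) 6 2)) ⟩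
      8 * (n * μ) + 9 * ℓ                       ∎

-- The lower bound

HasArrays : (n d : ℕ) → Family n
HasArrays n d G = ∃[ a ] AdjacencyArrays {n} {d} G a

-- Slots whose contents force the output, with decoys first, number at least
-- nd / 27.
module CertificateSize (n d : ℕ) .{{_ : NonZero n}} (1≤d : 1 ≤ d) (8d<n : 8 * d < n)
                       (A : Algorithm n d) (finds : FindsPerfectMatching A (HasArrays n d)) where
  module B = Base n d (<⇒≤ (≤-<-trans (m≤n*m d 8) 8d<n))

  module _ {b : Arrays n d} (valid : AdjacencyArrays B.graph b) {M : EdgeSet n} {t : ℕ}
           {L : List (Slot n d)} (first : DecoysFirst (λ x → 3 ∣ toℕ x) b L)
           (stable : ∀ c → Agree L b c → Runs A c M t) where

    -- Correctness on every input that L cannot tell from b.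
    matching : ∀ {G c} → AdjacencyArrays G c → Agree L b c → PerfectMatching G M
    matching {G} {c} vc ag with finds G (c , vc) c vc
    ... | _ , _ , run , pm = subst (PerfectMatching G) (output-unique A run (stable c ag)) pm

    open PerfectMatching (matching valid (λ _ → refl))

    -- The output as a map from P to Q.
    partner : Fin n → Fin n
    partner p = proj₁ (uniqueOn-P p)

    matched : ∀ p → T (M p (partner p))
    matched p = proj₁ (proj₂ (uniqueOn-P p))

    partner-injective : Injective _≡_ _≡_ partner
    partner-injective {p} {p′} eq with uniqueOn-Q (partner p)
    ... | _ , _ , unique = trans (sym (unique (matched p)))
                             (unique (subst (T ∘ M p′) (sym eq) (matched p′)))

    all-seen : 27 * length L < n * d → ∀ p → Seen b L (p , partner p)
    all-seen short p = decidable-stable (seen? b L _) λ ¬seen →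
      let _ , _ , vc , ag , ¬edge = unseen⇒switch valid (few-blocked n d (length L) 8d<n short)
                                      (edges p (partner p) (matched p)) ¬seen
      in ¬edge (PerfectMatching.edges (matching vc ag) p (partner p) (matched p))

    certificate-size : n * d ≤ 27 * length L
    certificate-size = ≮⇒≥ λ short → <⇒≱ short
      (many-charges n d (length L) (<-≤-trans (s≤s (*-monoʳ-≤ 8 1≤d)) 8d<n)
        (Charging.matching-cost valid (λ x → 3 ∣? toℕ x) first B.third B.third-injective
          B.decoy B.decoy-injective B.decoy-multiple (λ v k → B.arrays-adjacent v _)
          partner-injective (all-seen short)))

lower-bound : ∀ (n d : ℕ) .{{_ : NonZero n}} → 1 ≤ d → 8 * d < n →
              (A : Algorithm n d) → FindsPerfectMatching A (HasArrays n d) →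
              ∃[ G ] HasArrays n d G × (∃[ a ] AdjacencyArrays {n} {d} G a ×
              (∃[ M ] ∃[ t ] Runs A a M t × n * d ≤ 27 * t))
lower-bound n d 1≤d 8d<n A finds =
  fromForced (force (n * d) ≤-refl B.valid (λ j ()) λ c vc _ →
    let M , t , run , _ = finds B.graph (c , vc) c vc in M , t , run)
  where
  open CertificateSize n d 1≤d 8d<n A finds
  open Adversary A B.graph (λ x → 3 ∣? toℕ x) (n * d)
  fromForced : Forced (Algorithm.start A) B.arrays [] → _
  fromForced f = B.graph , (b , valid) , b , valid , M , t , run , slow outcome
    where
    open Forced f
    slow : n * d ≤ 0 + t ⊎ Certificate (Algorithm.start A) b [] M t → n * d ≤ 27 * t
    slow (inj₁ nd≤t) = ≤-trans nd≤t (m≤n*m t 27)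
    slow (inj₂ (L , _ , len , first , stable)) =
      ≤-trans (certificate-size valid first stable) (*-monoʳ-≤ 27 len)

scale : ∀ m t → m ≤ 27 * t → (ℤ.+ 1 ℚ./ 27) ℚ.* fromℕ m ℚ.≤ fromℕ t
scale m t m≤27t = toℚᵘ-cancel-≤ (begin
  ℚ.toℚᵘ ((ℤ.+ 1 ℚ./ 27) ℚ.* fromℕ m)            ≃⟨ toℚᵘ-homo-* (ℤ.+ 1 ℚ./ 27) (fromℕ m) ⟩
  mkℚᵘ (ℤ.+ 1) 26 ℚᵘ.* ℚ.toℚᵘ (fromℕ m)          ≃⟨ ℚᵘ.*-congˡ {mkℚᵘ (ℤ.+ 1) 26} (toℚᵘ-fromℚᵘ (mkℚᵘ (ℤ.+ m) 0)) ⟩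
  mkℚᵘ (ℤ.+ 1) 26 ℚᵘ.* mkℚᵘ (ℤ.+ m) 0            ≤⟨ ℚᵘ.*≤* ineq ⟩
  mkℚᵘ (ℤ.+ t) 0                                 ≃⟨ ℚᵘ.≃-sym (toℚᵘ-fromℚᵘ (mkℚᵘ (ℤ.+ t) 0)) ⟩
  ℚ.toℚᵘ (fromℕ t)                               ∎)
  where
  open import Data.Rational.Properties using (toℚᵘ-cancel-≤; toℚᵘ-homo-*; toℚᵘ-fromℚᵘ)
  open import Data.Rational.Unnormalised.Base as ℚᵘ using (mkℚᵘ)
  import Data.Rational.Unnormalised.Properties as ℚᵘ
  import Data.Integer.Properties as ℤ
  open ℚᵘ.≤-Reasoning
  ineq : (ℤ.+ 1 ℤ.* ℤ.+ m) ℤ.* ℤ.+ 1 ℤ.≤ ℤ.+ t ℤ.* ℤ.+ 27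
  ineq = subst₂ ℤ._≤_
    (sym (trans (ℤ.*-identityʳ _) (ℤ.*-identityˡ (ℤ.+ m))))
    (trans (cong ℤ.+_ (*-comm 27 t)) (ℤ.pos-* t 27))
    (ℤ.+≤+ m≤27t)

theorem2 : Σ[ c ∈ ℚ ] 0ℚ ℚ.< c ×
    (∀ (n d : ℕ) → 1 ≤ n → 1 ≤ d → 8 * d < n →
    Σ[ F ∈ Family n ]
    (∀ G → F G → Regular d G) ×
    (∀ (A : Algorithm n d) → FindsPerfectMatching A F →
    WorstCaseTimeAtLeast A F (c ℚ.* fromℕ (n * d))))
theorem2 = ℤ.+ 1 ℚ./ 27 , ℚ.*<* (ℤ.+<+ (s≤s z≤n)) , λ n d 1≤n 1≤d 8d<n →
  HasArrays n d , (λ _ (_ , valid) → arrays⇒regular valid) , λ A finds →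
    let G , G∈F , a , valid , M , t , run , nd≤27t =
          lower-bound n d {{>-nonZero 1≤n}} 1≤d 8d<n A finds
    in G , G∈F , a , valid , M , t , run , scale (n * d) t nd≤27t
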